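{- The set $\mathcal{F}$ of all fusible numbers, with the order inherited from $\mathbb{R}$, is well-ordered.
   Context: The fuse operation is the partial binary operation on real numbers $a\sim b=(a+b+1)/2$, applicable only when $|a-b|<1$. A fusible number is a real number obtainable from $0$ by finitely many (valid) applications of the fuse operation; i.e. the set $\mathcal{F}$ of fusible numbers is the smallest subset of $\mathbb{R}$ such that $0\in\mathcal{F}$ and, whenever $a,b\in\mathcal{F}$ and $|a-b|<1$, also $(a+b+1)/2\in\mathcal{F}$. -}

module Defs where

open import Axiom.ExcludedMiddle using (ExcludedMiddle)
open import Data.Integer.Base using (+_)
open import Data.Nat.Base as ℕ using (ℕ; suc)
import Data.Nat.Properties as ℕ
open import Data.Nat.Solver using (module +-*-Solver)
open import Data.Product.Base using (Σ; ∃; ∃-syntax; _×_; _,_; proj₁)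
open import Data.Rational.Base as ℚ using (ℚ; 0ℚ; 1ℚ; ½; _/_)
import Data.Rational.Properties as ℚ
import Data.Rational.Solver as ℚ-Solver
import Data.Rational.Unnormalised.Base as ℚᵘ
import Data.Rational.Unnormalised.Properties as ℚᵘ
open import Data.Sum.Base using (inj₁; inj₂)
open import Function.Base using (_on_)
open import Induction.WellFounded using (WellFounded; Acc; acc)
open import Level using (Level; 0ℓ; _⊔_)
open import Relation.Binary.Core using (Rel)
open import Relation.Binary.Structures using (IsStrictTotalOrder)
open import Relation.Binary.PropositionalEquality.Core
  using (_≡_; refl; sym; trans; cong; cong₂; subst; subst₂)
open import Relation.Nullary using (¬_; yes; no)
open import Relation.Unary using (Pred)

------------------------------------------------------------------------
-- Real numbers: Bishop's regular sequences of rationals.  Bishop's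
-- index k ≥ 1 is written suc n, so his bound 1/k is δ n.

δ : ℕ → ℚ
δ n = + 1 / suc n

record ℝ : Set where
  constructor mkℝ
  field
    seq     : ℕ → ℚ
    regular : ∀ m n → ℚ.∣ seq m ℚ.- seq n ∣ ℚ.≤ δ m ℚ.+ δ n

open ℝ public

-- suc (double n) = 2 * suc n

double : ℕ → ℕ
double n = suc (n ℕ.+ n)

private
  δ-double : ∀ n → δ (double n) ℚ.+ δ (double n) ≡ δ n
  δ-double n = ℚ.toℚᵘ-injective (begin-equality
    ℚ.toℚᵘ (δ (double n) ℚ.+ δ (double n))
      ≃⟨ ℚ.toℚᵘ-homo-+ (δ (double n)) (δ (double n)) ⟩
    ℚ.toℚᵘ (δ (double n)) ℚᵘ.+ ℚ.toℚᵘ (δ (double n))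
      ≃⟨ ℚᵘ.+-cong (ℚ.toℚᵘ-fromℚᵘ p) (ℚ.toℚᵘ-fromℚᵘ p) ⟩
    p ℚᵘ.+ p
      ≃⟨ ℚᵘ.*≡* (cong +_ (+-*-Solver.solve 1 (λ n →
           let open +-*-Solver
               d = con 2 :+ (n :+ n)
           in (con 1 :* d :+ con 1 :* d) :* (con 1 :+ n) := con 1 :* (d :* d))
           refl n)) ⟩
    ℚᵘ.mkℚᵘ (+ 1) n
      ≃⟨ ℚ.toℚᵘ-fromℚᵘ (ℚᵘ.mkℚᵘ (+ 1) n) ⟨
    ℚ.toℚᵘ (δ n) ∎)
    where
    open ℚᵘ.≤-Reasoning
    p = ℚᵘ.mkℚᵘ (+ 1) (double n)

  +-interchange : ∀ a b c d →
    (a ℚ.+ b) ℚ.- (c ℚ.+ d) ≡ (a ℚ.- c) ℚ.+ (b ℚ.- d)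
  +-interchange = solve 4 (λ a b c d →
    (a :+ b) :- (c :+ d) := (a :- c) :+ (b :- d)) refl
    where open ℚ-Solver.+-*-Solver

  δ-double₂ : ∀ m n →
    (δ (double m) ℚ.+ δ (double n)) ℚ.+ (δ (double m) ℚ.+ δ (double n))
      ≡ δ m ℚ.+ δ n
  δ-double₂ m n = trans
    (solve 2 (λ a b → (a :+ b) :+ (a :+ b) := (a :+ a) :+ (b :+ b)) refl
      (δ (double m)) (δ (double n)))
    (cong₂ ℚ._+_ (δ-double m) (δ-double n))
    where open ℚ-Solver.+-*-Solver

  p-q≡-[q-p] : ∀ p q → p ℚ.- q ≡ ℚ.- (q ℚ.- p)
  p-q≡-[q-p] = solve 2 (λ p q → p :- q := :- (q :- p)) refl
    where open ℚ-Solver.+-*-Solver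

  ∣p-q∣≡∣q-p∣ : ∀ p q → ℚ.∣ p ℚ.- q ∣ ≡ ℚ.∣ q ℚ.- p ∣
  ∣p-q∣≡∣q-p∣ p q = trans (cong ℚ.∣_∣ (p-q≡-[q-p] p q)) (ℚ.∣-p∣≡∣p∣ (q ℚ.- p))

  ∣p∣-∣q∣≤∣p-q∣ : ∀ p q → ℚ.∣ p ∣ ℚ.- ℚ.∣ q ∣ ℚ.≤ ℚ.∣ p ℚ.- q ∣
  ∣p∣-∣q∣≤∣p-q∣ p q = begin
    ℚ.∣ p ∣ ℚ.- ℚ.∣ q ∣
      ≡⟨ cong (λ r → ℚ.∣ r ∣ ℚ.- ℚ.∣ q ∣)
           (solve 2 (λ p q → p := (p :- q) :+ q) refl p q) ⟩
    ℚ.∣ (p ℚ.- q) ℚ.+ q ∣ ℚ.- ℚ.∣ q ∣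
      ≤⟨ ℚ.+-monoˡ-≤ (ℚ.- ℚ.∣ q ∣) (ℚ.∣p+q∣≤∣p∣+∣q∣ (p ℚ.- q) q) ⟩
    (ℚ.∣ p ℚ.- q ∣ ℚ.+ ℚ.∣ q ∣) ℚ.- ℚ.∣ q ∣
      ≡⟨ solve 2 (λ a b → (a :+ b) :- b := a) refl ℚ.∣ p ℚ.- q ∣ ℚ.∣ q ∣ ⟩
    ℚ.∣ p ℚ.- q ∣ ∎
    where
    open ℚ.≤-Reasoning
    open ℚ-Solver.+-*-Solver

  ∣∣p∣-∣q∣∣≤∣p-q∣ : ∀ p q → ℚ.∣ ℚ.∣ p ∣ ℚ.- ℚ.∣ q ∣ ∣ ℚ.≤ ℚ.∣ p ℚ.- q ∣
  ∣∣p∣-∣q∣∣≤∣p-q∣ p q with ℚ.∣p∣≡p∨∣p∣≡-p (ℚ.∣ p ∣ ℚ.- ℚ.∣ q ∣)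
  ... | inj₁ eq = subst (ℚ._≤ ℚ.∣ p ℚ.- q ∣) (sym eq) (∣p∣-∣q∣≤∣p-q∣ p q)
  ... | inj₂ eq = subst₂ ℚ._≤_
    (trans (p-q≡-[q-p] ℚ.∣ q ∣ ℚ.∣ p ∣) (sym eq))
    (∣p-q∣≡∣q-p∣ q p)
    (∣p∣-∣q∣≤∣p-q∣ q p)

infix  4 _≃_ _<_
infixl 6 _+_ _-_ _∼_
infix  8 -_
infixl 7 _/2

fromℚ : ℚ → ℝ
fromℚ q .seq     _   = q
fromℚ q .regular m n = begin
  ℚ.∣ q ℚ.- q ∣  ≡⟨ cong ℚ.∣_∣ (ℚ.+-inverseʳ q) ⟩
  0ℚ             ≤⟨ ℚ.+-mono-≤ (0≤δ m) (0≤δ n) ⟩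
  δ m ℚ.+ δ n    ∎
  where
  open ℚ.≤-Reasoning
  0≤δ : ∀ n → 0ℚ ℚ.≤ δ n
  0≤δ n = ℚ.nonNegative⁻¹ (δ n) {{ℚ.normalize-nonNeg 1 (suc n)}}

0ℝ 1ℝ : ℝ
0ℝ = fromℚ 0ℚ
1ℝ = fromℚ 1ℚ

_+_ : ℝ → ℝ → ℝ
(x + y) .seq     n   = seq x (double n) ℚ.+ seq y (double n)
(x + y) .regular m n = begin
  ℚ.∣ (seq x a ℚ.+ seq y a) ℚ.- (seq x b ℚ.+ seq y b) ∣
    ≡⟨ cong ℚ.∣_∣ (+-interchange (seq x a) (seq y a) (seq x b) (seq y b)) ⟩
  ℚ.∣ (seq x a ℚ.- seq x b) ℚ.+ (seq y a ℚ.- seq y b) ∣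
    ≤⟨ ℚ.∣p+q∣≤∣p∣+∣q∣ (seq x a ℚ.- seq x b) (seq y a ℚ.- seq y b) ⟩
  ℚ.∣ seq x a ℚ.- seq x b ∣ ℚ.+ ℚ.∣ seq y a ℚ.- seq y b ∣
    ≤⟨ ℚ.+-mono-≤ (regular x a b) (regular y a b) ⟩
  (δ a ℚ.+ δ b) ℚ.+ (δ a ℚ.+ δ b)
    ≡⟨ δ-double₂ m n ⟩
  δ m ℚ.+ δ n ∎
  where
  open ℚ.≤-Reasoning
  a = double m
  b = double n

-_ : ℝ → ℝ
(- x) .seq     n   = ℚ.- seq x n
(- x) .regular m n = begin
  ℚ.∣ (ℚ.- seq x m) ℚ.- (ℚ.- seq x n) ∣
    ≡⟨ cong ℚ.∣_∣ (solve 2 (λ p q → (:- p) :- (:- q) := q :- p) refl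
         (seq x m) (seq x n)) ⟩
  ℚ.∣ seq x n ℚ.- seq x m ∣
    ≡⟨ ∣p-q∣≡∣q-p∣ (seq x n) (seq x m) ⟩
  ℚ.∣ seq x m ℚ.- seq x n ∣
    ≤⟨ regular x m n ⟩
  δ m ℚ.+ δ n ∎
  where
  open ℚ.≤-Reasoning
  open ℚ-Solver.+-*-Solver

_-_ : ℝ → ℝ → ℝ
x - y = x + (- y)

∣_∣ : ℝ → ℝ
∣ x ∣ .seq     n   = ℚ.∣ seq x n ∣
∣ x ∣ .regular m n =
  ℚ.≤-trans (∣∣p∣-∣q∣∣≤∣p-q∣ (seq x m) (seq x n)) (regular x m n)

_/2 : ℝ → ℝ
(x /2) .seq     n   = seq x n ℚ.* ½
(x /2) .regular m n = begin
  ℚ.∣ seq x m ℚ.* ½ ℚ.- seq x n ℚ.* ½ ∣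
    ≡⟨ cong ℚ.∣_∣ (solve 2 (λ p q →
         p :* con ½ :- q :* con ½ := con ½ :* (p :- q)) refl
         (seq x m) (seq x n)) ⟩
  ℚ.∣ ½ ℚ.* (seq x m ℚ.- seq x n) ∣
    ≡⟨ ℚ.∣p*q∣≡∣p∣*∣q∣ ½ (seq x m ℚ.- seq x n) ⟩
  ½ ℚ.* d
    ≤⟨ ℚ.*-monoʳ-≤-nonNeg d {{ℚ.∣-∣-nonNeg (seq x m ℚ.- seq x n)}} ½≤1 ⟩
  1ℚ ℚ.* d
    ≡⟨ ℚ.*-identityˡ d ⟩
  d
    ≤⟨ regular x m n ⟩
  δ m ℚ.+ δ n ∎
  where
  open ℚ.≤-Reasoning
  open ℚ-Solver.+-*-Solver
  d = ℚ.∣ seq x m ℚ.- seq x n ∣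
  ½≤1 : ½ ℚ.≤ 1ℚ
  ½≤1 = ℚ.≤ᵇ⇒≤ _

_≃_ : Rel ℝ 0ℓ
x ≃ y = ∀ n → ℚ.∣ seq x n ℚ.- seq y n ∣ ℚ.≤ δ n ℚ.+ δ n

Positive : Pred ℝ 0ℓ
Positive x = ∃[ n ] δ n ℚ.< seq x n

_<_ : Rel ℝ 0ℓ
x < y = Positive (y - x)

------------------------------------------------------------------------
-- Fusible numbers

_∼_ : ℝ → ℝ → ℝ
a ∼ b = (a + b + 1ℝ) /2

-- The constructor resp makes Fusible a subset of the setoid (ℝ , _≃_):
-- different sequences may represent the same real number.

data Fusible : Pred ℝ 0ℓ where
  zero : Fusible 0ℝ
  fuse : ∀ {a b} → Fusible a → Fusible b → ∣ a - b ∣ < 1ℝ → Fusible (a ∼ b)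
  resp : ∀ {a b} → a ≃ b → Fusible a → Fusible b

𝓕 : Set
𝓕 = Σ ℝ Fusible

_≈𝓕_ : Rel 𝓕 0ℓ
_≈𝓕_ = _≃_ on proj₁

_<𝓕_ : Rel 𝓕 0ℓ
_<𝓕_ = _<_ on proj₁

------------------------------------------------------------------------
-- Well-orders

-- Well-foundedness is the constructive rendering of "every nonempty
-- subset has a least element"; the latter, for arbitrary subsets of a
-- two-element order, already implies excluded middle.  Under excluded
-- middle the least-element property follows: see least.

record IsWellOrder {a ℓ₁ ℓ₂} {A : Set a} (_≈_ : Rel A ℓ₁) (_<_ : Rel A ℓ₂) :
                   Set (a ⊔ ℓ₁ ⊔ ℓ₂) where
  field
    isStrictTotalOrder : IsStrictTotalOrder _≈_ _<_
    wellFounded        : WellFounded _<_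

  least : ∀ {p} → ExcludedMiddle (a ⊔ ℓ₂ ⊔ p) → (P : Pred A p) → ∃ P →
          ∃[ m ] P m × (∀ {x} → P x → ¬ (x < m))
  least {p} em P (x , Px) = go x (wellFounded x) Px
    where
    go : ∀ x → Acc _<_ x → P x → ∃[ m ] P m × (∀ {y} → P y → ¬ (y < m))
    go x (acc rs) Px with em {Level.Lift (a ⊔ ℓ₂ ⊔ p) (∃[ y ] P y × y < x)}
    ... | yes (Level.lift (y , Py , y<x)) = go y (rs y<x) Py
    ... | no  none = x , Px , λ Py y<x → none (Level.lift (_ , Py , y<x))

{-# OPTIONS --safe #-}

-- Every fusible number is rational, so the order is decided in ℚ and only
-- well-foundedness is at stake; it suffices that the accessible fusible
-- numbers are closed under p ∙ q = (p + q + 1) / 2.  Let p and q be accessible,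
-- and argue by induction on p.  A fusible a ∙ b < p ∙ q has accessible a and b,
-- by structural induction.  If a < p or b < p, then a ∙ b is accessible by the
-- induction hypothesis on p.  Otherwise p ≤ a, b, which forces a, b < q, and the
-- fusions of two elements of the well-ordered set of fusible numbers below q
-- are themselves well-founded (a two-summand Dickson lemma, acc-products).

module Submission where

open import Algebra.Definitions using (Commutative)
open import Data.Empty using (⊥-elim)
open import Data.Integer.Base as ℤ using (+_; +<+)
open import Data.Nat.Base as ℕ using (suc)
import Data.Nat.Properties as ℕ
import Data.Nat.Solver as ℕ-Solver
open import Data.Product.Base using (∃-syntax; _×_; _,_; proj₁; proj₂)
open import Data.Rational.Base as ℚ using (ℚ; 0ℚ; 1ℚ; ½; mkℚ; *<*)
import Data.Rational.Properties as ℚ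
open import Data.Rational.Solver using (module +-*-Solver)
import Data.Rational.Unnormalised.Base as ℚᵘ
import Data.Rational.Unnormalised.Properties as ℚᵘ
open import Data.Sum.Base using (inj₁; inj₂)
open import Induction.WellFounded using (Acc; acc; WellFounded; module Subrelation)
open import Level using (0ℓ)
open import Relation.Binary.Core using (Rel)
import Relation.Binary.Construct.On as On
import Relation.Binary.Morphism.OrderMonomorphism as OrderMonomorphism
open import Relation.Binary.Morphism.Structures using (IsOrderMonomorphism)
open import Relation.Binary.PropositionalEquality
  using (_≡_; refl; sym; trans; cong; subst; subst₂; module ≡-Reasoning)
open import Relation.Binary.Structures using (IsStrictTotalOrder)
open import Relation.Nullary using (¬_; yes; no)
open import Relation.Unary using (Pred; _∪_)

open import Defs

-- Well-foundedness of a set generated by a monotone operation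

module Generation
  {A : Set} {_<_ : Rel A 0ℓ} (isStrictTotalOrder : IsStrictTotalOrder _≡_ _<_)
  (_∙_ : A → A → A) (comm : Commutative _≡_ _∙_)
  (cancel : ∀ {p q r s} → ¬ (q < p) → (q ∙ r) < (p ∙ s) → r < s)
  (ε : A)
  where

  open IsStrictTotalOrder isStrictTotalOrder using (irrefl; _<?_) renaming (trans to <-trans)

  private variable
    S T : Pred A 0ℓ
    p q r s : A

  Below : Pred A 0ℓ → Rel A 0ℓ
  Below S q p = S q × q < p

  -- A descent from `p` never leaves the elements below `p`, so the implication is needed only
  -- there.
  acc-local : (∀ {q} → q < p → S q → T q) → Acc (Below T) p → Acc (Below S) p
  acc-local S⇒T (acc rs) = acc λ (Sq , q<p) →
    acc-local (λ r<q → S⇒T (<-trans r<q q<p)) (rs (S⇒T q<p Sq , q<p))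

  acc-∪ : Acc (Below S) p → Acc (Below T) p → Acc (Below (S ∪ T)) p
  acc-∪ {S = S} {T = T} acc-S acc-T = go acc-S acc-T (λ r<p → r<p) (λ r<p → r<p)
    where
    -- Induction on both accessibility proofs, at separate points `p` and `q`. A step to `x` moves
    -- only the point for the part of the union that holds `x`; inclusion of initial segments keeps
    -- the other usable.
    go : Acc (Below S) p → Acc (Below T) q →
         (∀ {s} → s < r → s < p) → (∀ {s} → s < r → s < q) →
         Acc (Below (S ∪ T)) r
    go (acc rs) (acc rt) r≼p r≼q = acc λ where
      (inj₁ Sx , x<r) → go (rs (Sx , r≼p x<r)) (acc rt)
                           (λ s<x → s<x) (λ s<x → r≼q (<-trans s<x x<r))
      (inj₂ Tx , x<r) → go (acc rs) (rt (Tx , r≼q x<r))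
                           (λ s<x → r≼p (<-trans s<x x<r)) (λ s<x → s<x)

  Products : Pred A 0ℓ → A → A → Pred A 0ℓ
  Products S p q r = ∃[ a ] ∃[ b ] (S a × a < p) × (S b × b < q) × r ≡ a ∙ b

  -- If c ∙ d < a ∙ b then c < a or d < b, so the products of Products S p q
  -- below a ∙ b split into Products S a q and Products S p b.
  acc-products : Acc (Below S) p → Acc (Below S) q → Acc (Below (Products S p q)) r
  acc-products {S} {p} {q} (acc rp) (acc rq) = acc λ
    { ((a , b , (Sa , a<p) , (Sb , b<q) , refl) , _) →
      acc-local (split a b) (acc-∪ (acc-products (rp (Sa , a<p)) (acc rq))
                                   (acc-products (acc rp) (rq (Sb , b<q)))) }
    where
    split : ∀ a b {r} → r < (a ∙ b) → Products S p q r →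
            (Products S a q ∪ Products S p b) r
    split a b r<a∙b (c , d , (Sc , c<p) , (Sd , d<q) , refl) with c <? a
    ... | yes c<a = inj₁ (c , d , (Sc , c<a) , (Sd , d<q) , refl)
    ... | no  c≮a = inj₂ (c , d , (Sc , c<p) , (Sd , cancel c≮a r<a∙b) , refl)

  -- For `_∼ℚ_`, `p < p ∼ℚ q` amounts to p - q < 1, so the two inequalities together encode |p - q|
  -- < 1.
  data Generated : Pred A 0ℓ where
    base : Generated ε
    op   : Generated p → Generated q → p < (p ∙ q) → q < (p ∙ q) → Generated (p ∙ q)

  Accessible : Pred A 0ℓ
  Accessible = Acc (Below Generated)

  ≮ε : Generated p → ¬ (p < ε)
  ≮ε base            = irrefl refl
  ≮ε (op Gp _ p<p∙q _) p∙q<ε = ≮ε Gp (<-trans p<p∙q p∙q<ε)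

  acc-ε : Accessible ε
  acc-ε = acc λ (Gq , q<ε) → ⊥-elim (≮ε Gq q<ε)

  acc-∙ : Accessible p → Accessible q → Accessible (p ∙ q)
  acc-∙ {p} {q} (acc rp) acc-q =
    acc λ (Gw , w<p∙q) → go (λ s<r → s<r) (acc-products acc-q acc-q) Gw w<p∙q
    where
    -- Lexicographic induction on the accessibility of `r`, then on the structure of `w`: the
    -- operands of `w` keep `r`, and the last case lowers `r` to `w`. The calls of `acc-∙` decrease
    -- the first argument only, hence its induction is over all `q`.
    go : ∀ {r w} → (∀ {s} → s < r → s < (p ∙ q)) →
         Acc (Below (Products Generated q q)) r →
         Generated w → w < r → Accessible w
    go r≼p∙q acc-r base _ = acc-ε
    go r≼p∙q acc-r@(acc rs) (op {a} {b} Ga Gb a<w b<w) w<r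
      with go r≼p∙q acc-r Ga (<-trans a<w w<r) | go r≼p∙q acc-r Gb (<-trans b<w w<r)
         | a <? p | b <? p
    ... | _     | acc-b | yes a<p | _       = acc-∙ (rp (Ga , a<p)) acc-b
    ... | acc-a | _     | no _    | yes b<p =
      subst Accessible (comm b a) (acc-∙ (rp (Gb , b<p)) acc-a)
    ... | _     | _     | no a≮p  | no b≮p  = acc λ (Gv , v<w) →
      go (λ s<w → r≼p∙q (<-trans s<w w<r))
         (rs ((a , b , (Ga , a<q) , (Gb , b<q) , refl) , w<r)) Gv v<w
      where
      b<q : b < q
      b<q = cancel a≮p (r≼p∙q w<r)
      a<q : a < q
      a<q = cancel b≮p (subst (_< (p ∙ q)) (comm a b) (r≼p∙q w<r))

  generated⇒acc : Generated p → Accessible p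
  generated⇒acc base           = acc-ε
  generated⇒acc (op Gp Gq _ _) = acc-∙ (generated⇒acc Gp) (generated⇒acc Gq)

-- The fuse operation on rationals

infixl 6 _∼ℚ_

_∼ℚ_ : ℚ → ℚ → ℚ
p ∼ℚ q = (p ℚ.+ q ℚ.+ 1ℚ) ℚ.* ½

∼ℚ-comm : ∀ p q → p ∼ℚ q ≡ q ∼ℚ p
∼ℚ-comm p q = cong (λ r → (r ℚ.+ 1ℚ) ℚ.* ½) (ℚ.+-comm p q)

∼ℚ-mono-≤ : ∀ {p q r s} → p ℚ.≤ q → r ℚ.≤ s → p ∼ℚ r ℚ.≤ q ∼ℚ s
∼ℚ-mono-≤ p≤q r≤s =
  ℚ.*-monoʳ-≤-nonNeg ½ (ℚ.+-monoˡ-≤ 1ℚ (ℚ.+-mono-≤ p≤q r≤s))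

∼ℚ-cancel-< : ∀ {p q r s} → ¬ (q ℚ.< p) → (q ∼ℚ r) ℚ.< (p ∼ℚ s) → r ℚ.< s
∼ℚ-cancel-< q≮p q∼r<p∼s = ℚ.≰⇒> λ s≤r → ℚ.<-irrefl refl
  (ℚ.<-≤-trans q∼r<p∼s (∼ℚ-mono-≤ (ℚ.≮⇒≥ q≮p) s≤r))

open Generation ℚ.<-isStrictTotalOrder _∼ℚ_ ∼ℚ-comm ∼ℚ-cancel-< 0ℚ

-- Distance estimates in the rationals

dist : ℚ → ℚ → ℚ
dist p q = ℚ.∣ p ℚ.- q ∣

p≤∣p∣ : ∀ p → p ℚ.≤ ℚ.∣ p ∣
p≤∣p∣ p with ℚ.≤-total 0ℚ p
... | inj₁ 0≤p = ℚ.≤-reflexive (sym (ℚ.0≤p⇒∣p∣≡p 0≤p))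
... | inj₂ p≤0 = ℚ.≤-trans p≤0 (ℚ.0≤∣p∣ p)

dist-sym : ∀ p q → dist p q ≡ dist q p
dist-sym p q = trans
  (cong ℚ.∣_∣ (solve 2 (λ p q → p :- q := :- (q :- p)) refl p q))
  (ℚ.∣-p∣≡∣p∣ (q ℚ.- p))
  where open +-*-Solver

dist-triangle : ∀ p q r → dist p r ℚ.≤ dist p q ℚ.+ dist q r
dist-triangle p q r = subst (λ s → ℚ.∣ s ∣ ℚ.≤ dist p q ℚ.+ dist q r)
  (solve 3 (λ p q r → (p :- q) :+ (q :- r) := p :- r) refl p q r)
  (ℚ.∣p+q∣≤∣p∣+∣q∣ (p ℚ.- q) (q ℚ.- r))
  where open +-*-Solver

dist-+ : ∀ p q r s → dist (p ℚ.+ q) (r ℚ.+ s) ℚ.≤ dist p r ℚ.+ dist q s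
dist-+ p q r s = subst (λ t → ℚ.∣ t ∣ ℚ.≤ dist p r ℚ.+ dist q s)
  (solve 4 (λ p q r s → (p :- r) :+ (q :- s) := (p :+ q) :- (r :+ s)) refl p q r s)
  (ℚ.∣p+q∣≤∣p∣+∣q∣ (p ℚ.- r) (q ℚ.- s))
  where open +-*-Solver

dist≤0⇒≡ : ∀ {p q} → dist p q ℚ.≤ 0ℚ → p ≡ q
dist≤0⇒≡ {p} {q} d≤0 = begin
  p                ≡⟨ solve 2 (λ p q → p := (p :- q) :+ q) refl p q ⟩
  p ℚ.- q ℚ.+ q    ≡⟨ cong (ℚ._+ q)
                         (ℚ.∣p∣≡0⇒p≡0 (p ℚ.- q) (ℚ.≤-antisym d≤0 (ℚ.0≤∣p∣ (p ℚ.- q)))) ⟩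
  0ℚ ℚ.+ q         ≡⟨ ℚ.+-identityˡ q ⟩
  q                ∎
  where
  open +-*-Solver
  open ≡-Reasoning

-- Replacing the 1 in the fusion by p - q gives p itself, and p - q ≤ |p - q| < 1.
p<p∼ℚq : ∀ {p q} → dist p q ℚ.< 1ℚ → p ℚ.< p ∼ℚ q
p<p∼ℚq {p} {q} d<1 = subst (ℚ._< p ∼ℚ q)
  (solve 2 (λ p q → (p :+ q :+ (p :- q)) :* con ½ := p) refl p q)
  (ℚ.*-monoˡ-<-pos ½ (ℚ.+-monoʳ-< (p ℚ.+ q) (ℚ.≤-<-trans (p≤∣p∣ (p ℚ.- q)) d<1)))
  where open +-*-Solver

generated-∼ℚ : ∀ {p q} → Generated p → Generated q → dist p q ℚ.< 1ℚ → Generated (p ∼ℚ q)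
generated-∼ℚ {p} {q} Gp Gq d<1 = op Gp Gq (p<p∼ℚq d<1)
  (subst (q ℚ.<_) (∼ℚ-comm q p) (p<p∼ℚq (subst (ℚ._< 1ℚ) (dist-sym p q) d<1)))

p<q⇒0<q-p : ∀ {p q} → p ℚ.< q → 0ℚ ℚ.< q ℚ.- p
p<q⇒0<q-p {p} {q} p<q = subst (ℚ._< q ℚ.- p) (ℚ.+-inverseʳ p) (ℚ.+-monoˡ-< (ℚ.- p) p<q)

+-cancelʳ-< : ∀ {p q r} → p ℚ.+ r ℚ.< q ℚ.+ r → p ℚ.< q
+-cancelʳ-< {r = r} p+r<q+r = ℚ.≰⇒> λ q≤p →
  ℚ.<-irrefl refl (ℚ.<-≤-trans p+r<q+r (ℚ.+-monoˡ-≤ r q≤p))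

p≤q+dist : ∀ p q → p ℚ.≤ q ℚ.+ dist p q
p≤q+dist p q = subst (ℚ._≤ q ℚ.+ dist p q)
  (solve 2 (λ p q → q :+ (p :- q) := p) refl p q)
  (ℚ.+-monoʳ-≤ q (p≤∣p∣ (p ℚ.- q)))
  where open +-*-Solver

p<q-r⇒p+r<q : ∀ {p q r} → p ℚ.< q ℚ.- r → p ℚ.+ r ℚ.< q
p<q-r⇒p+r<q {p} {q} {r} p<q-r = subst (p ℚ.+ r ℚ.<_)
  (solve 2 (λ q r → (q :- r) :+ r := q) refl q r) (ℚ.+-monoˡ-< r p<q-r)
  where open +-*-Solver

-- The bounds `δ` and the Archimedean property

δ>0 : ∀ n → 0ℚ ℚ.< δ n
δ>0 n = ℚ.positive⁻¹ (δ n) {{ℚ.normalize-pos 1 (suc n)}}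

δ-double : ∀ n → δ (double n) ℚ.+ δ (double n) ≡ δ n
δ-double n = ℚ.toℚᵘ-injective (begin-equality
  ℚ.toℚᵘ (δ (double n) ℚ.+ δ (double n))
    ≃⟨ ℚ.toℚᵘ-homo-+ (δ (double n)) (δ (double n)) ⟩
  ℚ.toℚᵘ (δ (double n)) ℚᵘ.+ ℚ.toℚᵘ (δ (double n))
    ≃⟨ ℚᵘ.+-cong (ℚ.toℚᵘ-fromℚᵘ d) (ℚ.toℚᵘ-fromℚᵘ d) ⟩
  d ℚᵘ.+ d
    ≃⟨ ℚᵘ.*≡* (cong +_ (solve 1 (λ n →
         let m = con 2 :+ (n :+ n)
         in (con 1 :* m :+ con 1 :* m) :* (con 1 :+ n) := con 1 :* (m :* m))
         refl n)) ⟩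
  ℚᵘ.mkℚᵘ (+ 1) n
    ≃⟨ ℚ.toℚᵘ-fromℚᵘ (ℚᵘ.mkℚᵘ (+ 1) n) ⟨
  ℚ.toℚᵘ (δ n) ∎)
  where
  open ℚᵘ.≤-Reasoning
  open ℕ-Solver.+-*-Solver
  d = ℚᵘ.mkℚᵘ (+ 1) (double n)

δ-double-≤ : ∀ n → δ (double n) ℚ.≤ δ n
δ-double-≤ n = subst₂ ℚ._≤_ (ℚ.+-identityˡ (δ (double n))) (δ-double n)
  (ℚ.+-monoˡ-≤ (δ (double n)) (ℚ.<⇒≤ (δ>0 (double n))))

archimedean : ∀ {p} → 0ℚ ℚ.< p → ∃[ n ] δ n ℚ.< p
archimedean {mkℚ (+ 0)       d _} (*<* (+<+ ()))
archimedean {mkℚ (ℤ.-[1+ _ ]) d _} (*<* ())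
-- `d` is the denominator minus one, so p = (a + 1) / (d + 1) ≥ 1 / (d + 1) > 1 / (d + 2). Taking
-- `d` as witness would fail to be strict at a = 0.
archimedean {p@(mkℚ (+ suc a) d _)} _ = suc d , ℚ.toℚᵘ-cancel-< (begin-strict
  ℚ.toℚᵘ (δ (suc d))
    ≃⟨ ℚ.toℚᵘ-fromℚᵘ (ℚᵘ.mkℚᵘ (+ 1) (suc d)) ⟩
  ℚᵘ.mkℚᵘ (+ 1) (suc d)
    <⟨ ℚᵘ.*<* (+<+ (ℕ.<-≤-trans
      (ℕ.*-monoʳ-< 1 (ℕ.n<1+n (suc d))) (ℕ.*-monoˡ-≤ (suc (suc d)) (ℕ.s≤s (ℕ.z≤n {a}))))) ⟩
  ℚ.toℚᵘ p ∎)
  where open ℚᵘ.≤-Reasoning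

≤-by-δ : ∀ {p q} → (∀ n → p ℚ.≤ q ℚ.+ δ n) → p ℚ.≤ q
≤-by-δ {p} {q} p≤q+δ = ℚ.≮⇒≥ λ q<p →
  let n , δ<p-q = archimedean (p<q⇒0<q-p q<p)
  in ℚ.<-irrefl refl (ℚ.<-≤-trans (p<q-r⇒p+r<q δ<p-q)
       (ℚ.≤-trans (p≤q+δ n) (ℚ.≤-reflexive (ℚ.+-comm q (δ n)))))

-- Real numbers with a rational value

infix 4 _↘_

-- Equality of `x` with `fromℚ q`, with `δ n` in place of `δ n + δ n`: regularity already puts
-- `seq x n` within `δ n` of the limit.
_↘_ : ℝ → ℚ → Set
x ↘ q = ∀ n → dist (seq x n) q ℚ.≤ δ n

0↘0 : 0ℝ ↘ 0ℚ
0↘0 n = ℚ.<⇒≤ (δ>0 n)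

∼-↘ : ∀ {x y p q} → x ↘ p → y ↘ q → x ∼ y ↘ p ∼ℚ q
∼-↘ {x} {y} {p} {q} x↘p y↘q n = begin
  dist ((a ℚ.+ b ℚ.+ 1ℚ) ℚ.* ½) (p ∼ℚ q)
    ≡⟨ cong ℚ.∣_∣ (solve 4 (λ a b p q →
         (a :+ b :+ con 1ℚ) :* con ½ :- (p :+ q :+ con 1ℚ) :* con ½ :=
         con ½ :* ((a :+ b) :- (p :+ q))) refl a b p q) ⟩
  ℚ.∣ ½ ℚ.* (a ℚ.+ b ℚ.- (p ℚ.+ q)) ∣
    ≡⟨ ℚ.∣p*q∣≡∣p∣*∣q∣ ½ (a ℚ.+ b ℚ.- (p ℚ.+ q)) ⟩
  ½ ℚ.* dist (a ℚ.+ b) (p ℚ.+ q)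
    ≤⟨ ℚ.*-monoˡ-≤-nonNeg ½ (dist-+ a b p q) ⟩
  ½ ℚ.* (dist a p ℚ.+ dist b q)
    ≤⟨ ℚ.*-monoˡ-≤-nonNeg ½ (ℚ.+-mono-≤ (x↘p m) (y↘q m)) ⟩
  ½ ℚ.* (δ m ℚ.+ δ m)
    ≡⟨ solve 1 (λ d → con ½ :* (d :+ d) := d) refl (δ m) ⟩
  δ m
    ≤⟨ δ-double-≤ (double n) ⟩
  δ (double n)
    ≤⟨ δ-double-≤ n ⟩
  δ n ∎
  where
  open ℚ.≤-Reasoning
  open +-*-Solver
  -- The two nested additions in `_∼_` each double the index.
  m = double (double n)
  a = seq x m
  b = seq y m

-- Passing through a far index `m` costs `δ n` plus four times `δ m`: one from regularity, two from
-- `x ≃ y`, one from `x ↘ q`. Doubling `k` twice turns the four into `δ k`.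
≃-↘ : ∀ {x y q} → x ≃ y → x ↘ q → y ↘ q
≃-↘ {x} {y} {q} x≃y x↘q n = ≤-by-δ λ k → let m = double (double k) in begin
  dist (seq y n) q
    ≤⟨ dist-triangle (seq y n) (seq y m) q ⟩
  dist (seq y n) (seq y m) ℚ.+ dist (seq y m) q
    ≤⟨ ℚ.+-mono-≤ (regular y n m) (dist-triangle (seq y m) (seq x m) q) ⟩
  δ n ℚ.+ δ m ℚ.+ (dist (seq y m) (seq x m) ℚ.+ dist (seq x m) q)
    ≤⟨ ℚ.+-monoʳ-≤ (δ n ℚ.+ δ m) (ℚ.+-mono-≤
         (subst (ℚ._≤ δ m ℚ.+ δ m) (dist-sym (seq x m) (seq y m)) (x≃y m)) (x↘q m)) ⟩
  δ n ℚ.+ δ m ℚ.+ (δ m ℚ.+ δ m ℚ.+ δ m)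
    ≡⟨ solve 2 (λ n m → n :+ m :+ (m :+ m :+ m) := n :+ ((m :+ m) :+ (m :+ m)))
         refl (δ n) (δ m) ⟩
  δ n ℚ.+ ((δ m ℚ.+ δ m) ℚ.+ (δ m ℚ.+ δ m))
    ≡⟨ cong (λ d → δ n ℚ.+ (d ℚ.+ d)) (δ-double (double k)) ⟩
  δ n ℚ.+ (δ (double k) ℚ.+ δ (double k))
    ≡⟨ cong (δ n ℚ.+_) (δ-double k) ⟩
  δ n ℚ.+ δ k ∎
  where
  open ℚ.≤-Reasoning
  open +-*-Solver

↘⇒≃ : ∀ {x y q} → x ↘ q → y ↘ q → x ≃ y
↘⇒≃ {x} {y} {q} x↘q y↘q n = ℚ.≤-trans (dist-triangle (seq x n) q (seq y n))
  (ℚ.+-mono-≤ (x↘q n) (subst (ℚ._≤ δ n) (dist-sym (seq y n) q) (y↘q n)))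

↘-unique : ∀ {x p q} → x ↘ p → x ↘ q → p ≡ q
↘-unique {x} {p} {q} x↘p x↘q = dist≤0⇒≡ (≤-by-δ λ n → let m = double n in begin
  dist p q
    ≤⟨ dist-triangle p (seq x m) q ⟩
  dist p (seq x m) ℚ.+ dist (seq x m) q
    ≤⟨ ℚ.+-mono-≤ (subst (ℚ._≤ δ m) (dist-sym (seq x m) p) (x↘p m)) (x↘q m) ⟩
  δ m ℚ.+ δ m
    ≡⟨ trans (δ-double n) (sym (ℚ.+-identityˡ (δ n))) ⟩
  0ℚ ℚ.+ δ n ∎)
  where open ℚ.≤-Reasoning

minus-↘ : ∀ {x y p q} → x ↘ p → y ↘ q → x - y ↘ p ℚ.- q
minus-↘ {x} {y} {p} {q} x↘p y↘q n = begin
  dist (a ℚ.- b) (p ℚ.- q)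
    ≤⟨ dist-+ a (ℚ.- b) p (ℚ.- q) ⟩
  dist a p ℚ.+ dist (ℚ.- b) (ℚ.- q)
    ≡⟨ cong (λ r → dist a p ℚ.+ ℚ.∣ r ∣)
         (solve 2 (λ b q → (:- b) :- (:- q) := q :- b) refl b q) ⟩
  dist a p ℚ.+ dist q b
    ≤⟨ ℚ.+-mono-≤ (x↘p m) (subst (ℚ._≤ δ m) (dist-sym b q) (y↘q m)) ⟩
  δ m ℚ.+ δ m
    ≡⟨ δ-double n ⟩
  δ n ∎
  where
  open ℚ.≤-Reasoning
  open +-*-Solver
  m = double n
  a = seq x m
  b = seq y m

positive-↘ : ∀ {x q} → x ↘ q → Positive x → 0ℚ ℚ.< q
positive-↘ {x} {q} x↘q (n , δ<x) = +-cancelʳ-< (begin-strict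
  0ℚ ℚ.+ δ n              ≡⟨ ℚ.+-identityˡ (δ n) ⟩
  δ n                     <⟨ δ<x ⟩
  seq x n                 ≤⟨ p≤q+dist (seq x n) q ⟩
  q ℚ.+ dist (seq x n) q  ≤⟨ ℚ.+-monoʳ-≤ q (x↘q n) ⟩
  q ℚ.+ δ n               ∎)
  where open ℚ.≤-Reasoning

↘-positive : ∀ {x q} → x ↘ q → 0ℚ ℚ.< q → Positive x
-- At `double k` the error `δ n` is half of `δ k`, so `seq x n` is at least q - δ n > δ n.
↘-positive {x} {q} x↘q 0<q = let k , δ<q = archimedean 0<q ; n = double k in
  n , +-cancelʳ-< (begin-strict
  δ n ℚ.+ δ n                   ≡⟨ δ-double k ⟩
  δ k                           <⟨ δ<q ⟩
  q                             ≤⟨ p≤q+dist q (seq x n) ⟩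
  seq x n ℚ.+ dist q (seq x n)  ≡⟨ cong (seq x n ℚ.+_) (dist-sym q (seq x n)) ⟩
  seq x n ℚ.+ dist (seq x n) q  ≤⟨ ℚ.+-monoʳ-≤ (seq x n) (x↘q n) ⟩
  seq x n ℚ.+ δ n               ∎)
  where open ℚ.≤-Reasoning

-- The slack `δ n` in the witness of `∣ x ∣ < 1ℝ` absorbs the distance from `q` to `seq x m`, where
-- `m` is the index at which the subtraction reads `x`.
∣∣<1-↘ : ∀ {x q} → x ↘ q → ∣ x ∣ < 1ℝ → ℚ.∣ q ∣ ℚ.< 1ℚ
∣∣<1-↘ {x} {q} x↘q (n , δ<1-∣x∣) = begin-strict
  ℚ.∣ q ∣
    ≡⟨ cong ℚ.∣_∣ (solve 2 (λ a q → q := (q :- a) :+ a) refl (seq x m) q) ⟩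
  ℚ.∣ q ℚ.- seq x m ℚ.+ seq x m ∣
    ≤⟨ ℚ.∣p+q∣≤∣p∣+∣q∣ (q ℚ.- seq x m) (seq x m) ⟩
  dist q (seq x m) ℚ.+ ℚ.∣ seq x m ∣
    ≡⟨ cong (ℚ._+ ℚ.∣ seq x m ∣) (dist-sym q (seq x m)) ⟩
  dist (seq x m) q ℚ.+ ℚ.∣ seq x m ∣
    ≤⟨ ℚ.+-monoˡ-≤ ℚ.∣ seq x m ∣ (ℚ.≤-trans (x↘q m) (δ-double-≤ n)) ⟩
  δ n ℚ.+ ℚ.∣ seq x m ∣
    <⟨ p<q-r⇒p+r<q δ<1-∣x∣ ⟩
  1ℚ ∎
  where
  open ℚ.≤-Reasoning
  open +-*-Solver
  m = double n

-- Rational values of fusible numbers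

fusible⇒generated : ∀ {x} → Fusible x → ∃[ q ] Generated q × x ↘ q
fusible⇒generated zero = 0ℚ , base , 0↘0
fusible⇒generated (fuse {a} {b} Fa Fb ∣a-b∣<1) =
  let p , Gp , a↘p = fusible⇒generated Fa
      q , Gq , b↘q = fusible⇒generated Fb
  in p ∼ℚ q
   , generated-∼ℚ Gp Gq (∣∣<1-↘ {a - b} (minus-↘ {a} {b} a↘p b↘q) ∣a-b∣<1)
   , ∼-↘ {a} {b} a↘p b↘q
fusible⇒generated (resp {a} {b} a≃b Fa) =
  let q , Gq , a↘q = fusible⇒generated Fa
  in q , Gq , ≃-↘ {a} {b} a≃b a↘q

value : 𝓕 → ℚ
value (_ , Fx) = proj₁ (fusible⇒generated Fx)

value-generated : ∀ x → Generated (value x)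
value-generated (_ , Fx) = proj₁ (proj₂ (fusible⇒generated Fx))

↘-value : ∀ x → proj₁ x ↘ value x
↘-value (_ , Fx) = proj₂ (proj₂ (fusible⇒generated Fx))

value-minus : ∀ x y → proj₁ y - proj₁ x ↘ value y ℚ.- value x
value-minus x y = minus-↘ {proj₁ y} {proj₁ x} (↘-value y) (↘-value x)

value-mono-< : ∀ x y → x <𝓕 y → value x ℚ.< value y
value-mono-< x y x<y = subst₂ ℚ._<_ (ℚ.+-identityˡ (value x))
  (solve 2 (λ p q → (q :- p) :+ p := q) refl (value x) (value y))
  (ℚ.+-monoˡ-< (value x) (positive-↘ {proj₁ y - proj₁ x} (value-minus x y) x<y))
  where open +-*-Solver

-- Transfer of the order from the rationals

value-isOrderMonomorphism : IsOrderMonomorphism _≈𝓕_ _≡_ _<𝓕_ ℚ._<_ value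
value-isOrderMonomorphism = record
  { isOrderHomomorphism = record
    { cong = λ {x} {y} x≈y → ↘-unique {proj₁ y}
        (≃-↘ {proj₁ x} {proj₁ y} x≈y (↘-value x)) (↘-value y)
    ; mono = λ {x} {y} → value-mono-< x y
    }
  ; injective = λ {x} {y} vx≡vy → ↘⇒≃ {proj₁ x} {proj₁ y} (↘-value x)
      (subst (proj₁ y ↘_) (sym vx≡vy) (↘-value y))
  ; cancel = λ {x} {y} vx<vy → ↘-positive {proj₁ y - proj₁ x}
      (value-minus x y) (p<q⇒0<q-p vx<vy)
  }

-- Values are generated, so `_<𝓕_` lies inside the pullback of `Below Generated` along `value`.
<𝓕-wellFounded : WellFounded _<𝓕_
<𝓕-wellFounded x = Subrelation.accessible
  (λ {y} {z} y<z → value-generated y , value-mono-< y z y<z)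
  (On.accessible value (generated⇒acc (value-generated x)))

theorem2 : IsWellOrder _≈𝓕_ _<𝓕_
theorem2 = record
  { isStrictTotalOrder = OrderMonomorphism.isStrictTotalOrder
      value-isOrderMonomorphism ℚ.<-isStrictTotalOrder
  ; wellFounded = <𝓕-wellFounded
  }
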